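{- Let $G$ be an undirected, simple, finite, connected graph containing at least one edge. Then $\mu_{21}(G)=|V(G)|$ if and only if $G$ is a galaxy.
   Context: All graphs are undirected, simple, finite, connected, and contain at least one edge. $V(G)$ and $E(G)$ denote the vertex set and edge set of $G$. For a positive integer $t$, a proper edge $t$-coloring of $G$ is a function $\varphi:E(G)\to\{1,\dots,t\}$ such that adjacent edges receive different colors and each of the $t$ colors is used (i.e. $\varphi$ is surjective). $\chi'(G)$ is the least $t$ for which a proper edge $t$-coloring of $G$ exists. For an integer $t$ with $\chi'(G)\le t\le |E(G)|$, $\alpha(G,t)$ denotes the set of all proper edge $t$-colorings of $G$. An interval is a nonempty finite set of consecutive integers. For a proper edge coloring $\varphi$ of $G$ and $x\in V(G)$, $S_G(x,\varphi)$ is the set of colors of the edges incident with $x$, and $$f_G(\varphi)=|\{x\in V(G) : S_G(x,\varphi)\text{ is an interval}\}|.$$ For $\chi'(G)\le t\le|E(G)|$ define $\mu_2(G,t)=\max_{\varphi\in\alpha(G,t)} f_G(\varphi)$, and define $$\mu_{21}(G)=\min_{\chi'(G)\le t\le |E(G)|}\mu_2(G,t).$$ Galaxy: for an integer $n\ge 3$ and a sequence $A_{n-2}=(a_1,\dots,a_{n-2})$ of nonnegative integers, let $T[A_{n-2}]$ be the graph whose vertices are the (pairwise distinct) elements $x_1,\dots,x_n$ together with $y_{i,j}$ for $2\le i\le n-1$, $1\le j\le a_{i-1}$ (no $y_{i,j}$ for those $i$ with $a_{i-1}=0$), and whose edges are $(x_i,x_{i+1})$ for $1\le i\le n-1$ together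 with $(x_i,y_{i,j})$ for $2\le i\le n-1$, $1\le j\le a_{i-1}$. A graph $G$ is called a galaxy if either $G\cong K_2$, or there exist an integer $n\ge3$ and a sequence $A_{n-2}$ of nonnegative integers such that $G\cong T[A_{n-2}]$. -}

module Defs where

open import Data.Fin.Base using (Fin; suc; inject₁) renaming (_≤_ to _≤ᶠ_; _<_ to _<ᶠ_)
open import Data.Fin.Properties using (any?; all?) renaming (_≟_ to _≟ᶠ_; _≤?_ to _≤ᶠ?_; _<?_ to _<ᶠ?_)
open import Data.List.Base using (List; allFin; cartesianProduct; filter; length; lookup)
open import Data.Nat.Base using (ℕ; suc; _+_; _≤_)
open import Data.Product.Base using (Σ-syntax; ∃; ∃-syntax; ∃₂; _×_; _,_; proj₁; proj₂)
open import Data.Sum.Base using (_⊎_)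
open import Data.Vec.Base as Vec using (Vec)
open import Function.Bundles using (_⇔_; mk⇔; _↔_; Inverse; Equivalence)
open import Function.Definitions using (Surjective)
open import Level using (0ℓ)
open import Relation.Binary.Construct.Closure.ReflexiveTransitive using (Star)
open import Relation.Binary.Construct.Closure.Symmetric using (SymClosure)
open import Relation.Binary.Core using (Rel)
open import Relation.Binary.Definitions using (Irreflexive; Symmetric) renaming (Decidable to Decidable₂)
open import Relation.Binary.PropositionalEquality.Core using (_≡_; _≢_)
open import Relation.Nullary.Decidable using (Dec; map′; _×-dec_; _⊎-dec_; _→-dec_)
open import Relation.Unary using (Pred; Decidable)

IsLeast : Pred ℕ 0ℓ → Pred ℕ 0ℓ
IsLeast P m = P m × (∀ {k} → P k → m ≤ k)

IsGreatest : Pred ℕ 0ℓ → Pred ℕ 0ℓ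
IsGreatest P m = P m × (∀ {k} → P k → k ≤ m)

record Graph : Set₁ where
  field
    ∣V∣     : ℕ

  V : Set
  V = Fin ∣V∣

  field
    _~_     : Rel V 0ℓ
    _~?_    : Decidable₂ _~_
    ~-sym   : Symmetric _~_
    ~-irrefl : Irreflexive _≡_ _~_

  -- Each edge {u , v} is listed exactly once, as the pair with u < v.
  edges : List (V × V)
  edges = filter (λ (u , v) → (u <ᶠ? v) ×-dec (u ~? v))
                 (cartesianProduct (allFin ∣V∣) (allFin ∣V∣))

  ∣E∣ : ℕ
  ∣E∣ = length edges

  E : Set
  E = Fin ∣E∣

  IncidentWith : V → Pred E 0ℓ
  IncidentWith x e = x ≡ proj₁ (lookup edges e) ⊎ x ≡ proj₂ (lookup edges e)

  incidentWith? : ∀ x → Decidable (IncidentWith x)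
  incidentWith? x e = (x ≟ᶠ proj₁ (lookup edges e)) ⊎-dec (x ≟ᶠ proj₂ (lookup edges e))

  AdjacentEdges : Rel E 0ℓ
  AdjacentEdges e e′ = e ≢ e′ × ∃[ x ] (IncidentWith x e × IncidentWith x e′)

  Connected : Set
  Connected = ∀ u v → Star _~_ u v

  HasEdge : Set
  HasEdge = ∃₂ _~_

-- The colors 1, …, t are represented by Fin t, the element c standing for
-- the color suc (toℕ c); being an interval is invariant under this shift.

IsInterval : ∀ {t} → Pred (Pred (Fin t) 0ℓ) 0ℓ
IsInterval {t} S = ∃₂ λ (a b : Fin t) → a ≤ᶠ b × (∀ c → S c ⇔ (a ≤ᶠ c × c ≤ᶠ b))

isInterval? : ∀ {t} {S : Pred (Fin t) 0ℓ} → Decidable S → Dec (IsInterval S)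
isInterval? S? = any? λ a → any? λ b → (a ≤ᶠ? b) ×-dec all? λ c →
  let within? = (a ≤ᶠ? c) ×-dec (c ≤ᶠ? b) in
  map′ (λ (f , g) → mk⇔ f g) (λ eq → Equivalence.to eq , Equivalence.from eq)
       ((S? c →-dec within?) ×-dec (within? →-dec S? c))

module _ (G : Graph) where
  open Graph G

  record α (t : ℕ) : Set where
    field
      color      : E → Fin t
      proper     : ∀ {e e′} → AdjacentEdges e e′ → color e ≢ color e′
      surjective : Surjective _≡_ _≡_ color

module _ {G : Graph} {t : ℕ} (φ : α G t) where
  open Graph G
  open α φ

  S : V → Pred (Fin t) 0ℓ
  S x c = ∃[ e ] (IncidentWith x e × color e ≡ c)

  S? : ∀ x → Decidable (S x)
  S? x c = any? λ e → incidentWith? x e ×-dec (color e ≟ᶠ c)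

  f : ℕ
  f = length (filter (λ x → isInterval? (S? x)) (allFin ∣V∣))

-- χ′, μ₂ and μ₂₁ are given as relations with their values:  χ′[ G ]≡ k
-- reads  χ′(G) = k,  and similarly for the other two.

χ′[_]≡_ : Graph → Pred ℕ 0ℓ
χ′[ G ]≡ k = IsLeast (α G) k

Admissible : Graph → Pred ℕ 0ℓ
Admissible G t = (∃[ k ] (χ′[ G ]≡ k × k ≤ t)) × t ≤ Graph.∣E∣ G

μ₂[_,_]≡_ : Graph → ℕ → Pred ℕ 0ℓ
μ₂[ G , t ]≡ m = IsGreatest (λ k → ∃[ φ ] (f {G} {t} φ ≡ k)) m

μ₂₁[_]≡_ : Graph → Pred ℕ 0ℓ
μ₂₁[ G ]≡ m = IsLeast (λ k → ∃[ t ] (Admissible G t × μ₂[ G , t ]≡ k)) m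

record Isomorphism {V W : Set} (_~_ : Rel V 0ℓ) (_≈_ : Rel W 0ℓ) : Set where
  field
    bijection : V ↔ W
  open Inverse bijection public using (to; from)
  field
    adjacency : ∀ u v → u ~ v ⇔ to u ≈ to v

-- For A of length k = n - 2, the vertex x (with 0-based index i) stands for
-- x_{i+1}, and y i j for y_{i+2,j+1}; the latter hangs off x_{i+2}, whose
-- 0-based index is suc (inject₁ i).

module T {k : ℕ} (A : Vec ℕ k) where

  data Vertex : Set where
    x : Fin (2 + k) → Vertex
    y : (i : Fin k) → Fin (Vec.lookup A i) → Vertex

  data Edge : Rel Vertex 0ℓ where
    spine   : (i : Fin (suc k)) → Edge (x (inject₁ i)) (x (suc i))
    pendant : (i : Fin k) (j : Fin (Vec.lookup A i)) → Edge (x (suc (inject₁ i))) (y i j)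

  Adjacent : Rel Vertex 0ℓ
  Adjacent = SymClosure Edge

K₂ : Rel (Fin 2) 0ℓ
K₂ = _≢_

-- The length suc k of A expresses n ≥ 3.
IsGalaxy : Graph → Set
IsGalaxy G = Isomorphism _~_ K₂
           ⊎ (∃[ k ] Σ[ A ∈ Vec ℕ (suc k) ] Isomorphism _~_ (T.Adjacent A))
  where open Graph G

{-# OPTIONS --safe #-}

-- With |E| colors every proper coloring is a bijection. If all its color sets
-- are intervals, then by connectivity the edges colored γ and γ + 1 always
-- share a vertex, and reading the edges in the order of their colors unrolls G
-- along a spine: the largest color at one spine vertex is the smallest color at
-- the next, and the colors strictly in between belong to pendant edges.
--
-- Conversely, let m + 1 colors be available on T[A], numbered 0, …, m. Number
-- the edges at each spine vertex, starting with the edge from the preceding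
-- spine vertex, of color c, and ending with the edge to the following one; color
-- them c, c + 1, … up to m and then, if there are more, c - 1, c - 2, ….
-- Every color set is then an interval, and as long as m has not been reached
-- the colors run through 0, 1, 2, …, so that all of them get used.

module Submission where

open import Defs
open import Data.Fin.Base using (Fin; zero; suc; inject₁; toℕ; fromℕ; fromℕ<; punchOut; finToFun; funToFin) renaming (_<_ to _<ᶠ_)
open import Data.Fin.Properties as Fin using (any?; all?; toℕ<n; toℕ-fromℕ<; toℕ-injective; toℕ-inject₁; toℕ-fromℕ; inject₁-injective; fromℕ≢inject₁; punchOut-injective; finToFun-funToFin)
open import Data.Fin.Relation.Unary.Top using (view; view-fromℕ; view-inject₁; ‵fromℕ; ‵inject₁)
open import Data.List.Base using (List; allFin; cartesianProduct; length; lookup)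
open import Data.List.Membership.Propositional using (_∈_; lose)
open import Data.List.Membership.Propositional.Properties using (∈-allFin; ∈-cartesianProduct⁺; ∈-filter⁺; ∈-filter⁻; ∈-lookup)
import Data.List.Properties as List
import Data.List.Relation.Unary.All as All
open import Data.List.Relation.Unary.AllPairs using (_∷_)
open import Data.List.Relation.Unary.Any using (index)
open import Data.List.Relation.Unary.Any.Properties using (lookup-index)
open import Data.List.Relation.Unary.Unique.Propositional using (Unique)
open import Data.List.Relation.Unary.Unique.Propositional.Properties using (allFin⁺; cartesianProduct⁺; filter⁺)
open import Data.Nat.Base using (ℕ; zero; suc; _+_; _∸_; _⊔_; _≤_; _<_; z≤n; s≤s)
open import Data.Nat.Properties as ℕ using (_≤?_; _<?_)
open import Data.Product.Base using (∃; ∃-syntax; ∃₂; _×_; _,_; proj₁; proj₂)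
open import Data.Sum.Base as Sum using (_⊎_; inj₁; inj₂)
open import Data.Vec.Base as Vec using (Vec; []; _∷_)
open import Function.Base using (_∘_; id)
open import Function.Bundles using (_⇔_; mk⇔; mk↔ₛ′; Equivalence; Inverse)
open import Function.Construct.Composition using (_↔-∘_; _⇔-∘_)
open import Function.Construct.Symmetry using (↔-sym)
open import Function.Definitions using (Injective; Surjective)
open import Level using (0ℓ)
open import Relation.Binary.Construct.Closure.ReflexiveTransitive using (Star; ε; _◅_)
open import Relation.Binary.Construct.Closure.Symmetric using (fwd; bwd)
open import Relation.Binary.Core using (Rel)
open import Relation.Binary.Definitions using (tri<; tri≈; tri>)
open import Relation.Binary.PropositionalEquality
open import Relation.Nullary using (¬_; Dec; yes; no; contradiction)
open import Relation.Nullary.Decidable using (map′; _×-dec_; _→-dec_; decidable-stable)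
open import Relation.Unary using (Pred; Decidable)

open T using (Vertex; Edge; Adjacent; x; y; spine; pendant)

-- Edges and their ends

lookup-unique : ∀ {A : Set} {xs : List A} → Unique xs →
                ∀ {i j} → lookup xs i ≡ lookup xs j → i ≡ j
lookup-unique (_ ∷ _)   {zero}  {zero}  _  = refl
lookup-unique (x∉ ∷ _)  {zero}  {suc j} eq = contradiction eq (All.lookup x∉ (∈-lookup j))
lookup-unique (x∉ ∷ _)  {suc i} {zero}  eq = contradiction (sym eq) (All.lookup x∉ (∈-lookup i))
lookup-unique (_ ∷ xs!) {suc i} {suc j} eq = cong suc (lookup-unique xs! eq)

module _ (G : Graph) where
  open Graph G

  -- Edges are stored as increasing pairs; this relation is symmetric, so later arguments need not
  -- distinguish the order of the ends.
  Joins : V → V → E → Set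
  Joins u v e = IncidentWith u e × IncidentWith v e × u ≢ v

module _ {G : Graph} where
  open Graph G

  joins-sym : ∀ {u v e} → Joins G u v e → Joins G v u e
  joins-sym (iu , iv , u≢v) = iv , iu , u≢v ∘ sym

  private
    edge? = λ ((u , v) : V × V) → (u Fin.<? v) ×-dec (u ~? v)

    pairs : List (V × V)
    pairs = cartesianProduct (allFin ∣V∣) (allFin ∣V∣)

    ends : E → V × V
    ends = lookup edges

    edge-props : ∀ e → proj₁ (ends e) <ᶠ proj₂ (ends e) × proj₁ (ends e) ~ proj₂ (ends e)
    edge-props e = proj₂ (∈-filter⁻ edge? {xs = pairs} (∈-lookup e))

    ends-injective : ∀ {e e′} → ends e ≡ ends e′ → e ≡ e′
    ends-injective = lookup-unique
      (filter⁺ edge? (cartesianProduct⁺ (allFin⁺ ∣V∣) (allFin⁺ ∣V∣)))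

    edge-of-< : ∀ {u v} → u <ᶠ v → u ~ v → ∃ (Joins G u v)
    edge-of-< {u} {v} u<v u~v = index uv∈ , inj₁ (cong proj₁ eq) , inj₂ (cong proj₂ eq) , Fin.<⇒≢ u<v
      where
      uv∈ : (u , v) ∈ edges
      uv∈ = ∈-filter⁺ edge? (∈-cartesianProduct⁺ (∈-allFin u) (∈-allFin v)) (u<v , u~v)
      eq = lookup-index uv∈

    joins-ends : ∀ {u v e} → u <ᶠ v → Joins G u v e → ends e ≡ (u , v)
    joins-ends u<v (inj₁ p , inj₁ q , u≢v) = contradiction (trans p (sym q)) u≢v
    joins-ends u<v (inj₁ p , inj₂ q , u≢v) = cong₂ _,_ (sym p) (sym q)
    joins-ends u<v (inj₂ p , inj₂ q , u≢v) = contradiction (trans p (sym q)) u≢v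
    joins-ends {e = e} u<v (inj₂ refl , inj₁ refl , u≢v) =
      contradiction (proj₁ (edge-props e)) (Fin.<-asym u<v)

  edge-of : ∀ {u v} → u ~ v → ∃ (Joins G u v)
  edge-of {u} {v} u~v with Fin.<-cmp u v
  ... | tri< u<v _ _ = edge-of-< u<v u~v
  ... | tri≈ _ u≡v _ = contradiction u~v (~-irrefl u≡v)
  ... | tri> _ _ v<u = let e , j = edge-of-< v<u (~-sym u~v) in e , joins-sym j

  joins-unique : ∀ {u v e e′} → Joins G u v e → Joins G u v e′ → e ≡ e′
  joins-unique {u} {v} j j′ with Fin.<-cmp u v
  ... | tri< u<v _ _ = ends-injective (trans (joins-ends u<v j) (sym (joins-ends u<v j′)))
  ... | tri≈ _ u≡v _ = contradiction u≡v (proj₂ (proj₂ j))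
  ... | tri> _ _ v<u = ends-injective (trans (joins-ends v<u (joins-sym j))
                                             (sym (joins-ends v<u (joins-sym j′))))

  joins⇒~ : ∀ {u v e} → Joins G u v e → u ~ v
  joins⇒~ (inj₁ p , inj₁ q , u≢v) = contradiction (trans p (sym q)) u≢v
  joins⇒~ {e = e} (inj₁ refl , inj₂ refl , _) = proj₂ (edge-props e)
  joins⇒~ {e = e} (inj₂ refl , inj₁ refl , _) = ~-sym (proj₂ (edge-props e))
  joins⇒~ (inj₂ p , inj₂ q , u≢v) = contradiction (trans p (sym q)) u≢v

  otherEnd : ∀ {u e} → IncidentWith u e → ∃[ v ] Joins G u v e
  otherEnd {e = e} (inj₁ refl) = _ , inj₁ refl , inj₂ refl , Fin.<⇒≢ (proj₁ (edge-props e))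
  otherEnd {e = e} (inj₂ refl) = _ , inj₂ refl , inj₁ refl , Fin.<⇒≢ (proj₁ (edge-props e)) ∘ sym

  joins-incident : ∀ {u v w e} → Joins G u v e → IncidentWith w e → w ≡ u ⊎ w ≡ v
  joins-incident (inj₁ p , inj₁ q , u≢v) _        = contradiction (trans p (sym q)) u≢v
  joins-incident (inj₁ p , inj₂ q , _)   (inj₁ r) = inj₁ (trans r (sym p))
  joins-incident (inj₁ p , inj₂ q , _)   (inj₂ r) = inj₂ (trans r (sym q))
  joins-incident (inj₂ p , inj₁ q , _)   (inj₁ r) = inj₂ (trans r (sym q))
  joins-incident (inj₂ p , inj₁ q , _)   (inj₂ r) = inj₁ (trans r (sym p))
  joins-incident (inj₂ p , inj₂ q , u≢v) _        = contradiction (trans p (sym q)) u≢v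

  someEnds : ∀ e → ∃₂ λ u v → Joins G u v e
  someEnds e = _ , otherEnd (inj₁ refl)

  joins-ends-agree : ∀ {u v u′ v′ e} → Joins G u v e → Joins G u′ v′ e →
                     (u ≡ u′ × v ≡ v′) ⊎ (u ≡ v′ × v ≡ u′)
  joins-ends-agree {e = e} (u∈e , v∈e , u≢v) j with joins-incident {e = e} j u∈e | joins-incident {e = e} j v∈e
  ... | inj₁ p | inj₁ q = contradiction (trans p (sym q)) u≢v
  ... | inj₁ p | inj₂ q = inj₁ (p , q)
  ... | inj₂ p | inj₁ q = inj₂ (p , q)
  ... | inj₂ p | inj₂ q = contradiction (trans p (sym q)) u≢v

-- The rooted tree T[A], its edges named by their child ends

-- The root x zero has no parent; its value is junk.
par : ∀ {k} {A : Vec ℕ k} → Vertex A → Vertex A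
par (x zero)    = x zero
par (x (suc i)) = x (inject₁ i)
par (y i j)     = x (suc (inject₁ i))

module _ {k} {A : Vec ℕ k} where

  par-edge : ∀ {v : Vertex A} → v ≢ x zero → Edge A (par v) v
  par-edge {x zero}    v≢ = contradiction refl v≢
  par-edge {x (suc i)} _  = spine i
  par-edge {y i j}     _  = pendant i j

  edge-par : ∀ {u v} → Edge A u v → u ≡ par v
  edge-par (spine i)     = refl
  edge-par (pendant i j) = refl

  edge-nonroot : ∀ {u v} → Edge A u v → v ≢ x zero
  edge-nonroot (spine i)     ()
  edge-nonroot (pendant i j) ()

  -- The distance from the root; it shows that `Edge` is asymmetric.
  depth : Vertex A → ℕ
  depth (x i)   = toℕ i
  depth (y i j) = 2 + toℕ i

  edge-depth : ∀ {u v} → Edge A u v → depth v ≡ suc (depth u)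
  edge-depth (spine i)     = cong suc (sym (toℕ-inject₁ i))
  edge-depth (pendant i j) = cong (2 +_) (sym (toℕ-inject₁ i))

  edge-asym : ∀ {u v} → Edge A u v → ¬ Edge A v u
  edge-asym uv vu = ℕ.<-asym (ℕ.≤-reflexive (sym (edge-depth uv))) (ℕ.≤-reflexive (sym (edge-depth vu)))

  x-injective : ∀ {i j} → x {A = A} i ≡ x j → i ≡ j
  x-injective refl = refl

  -- An edge is named by its child end v; EdgeAt u v says that it is incident
  -- with u.
  EdgeAt : Vertex A → Vertex A → Set
  EdgeAt u v = Edge A u v ⊎ (v ≡ u × u ≢ x zero)

  hub : Fin k → Vertex A
  hub i = x (suc (inject₁ i))

  -- Lists the edges at hub `i` in the order in which they are numbered. They are named by child
  -- ends, so the first entry, the edge from the preceding spine vertex, is the hub itself.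
  nb : ∀ i → Fin (2 + Vec.lookup A i) → Vertex A
  nb i zero = hub i
  nb i (suc j) with view j
  ... | ‵fromℕ     = x (suc (suc i))
  ... | ‵inject₁ j = y i j

  nb-edgeAt : ∀ i j → EdgeAt (hub i) (nb i j)
  nb-edgeAt i zero = inj₂ (refl , λ ())
  nb-edgeAt i (suc j) with view j
  ... | ‵fromℕ     = inj₁ (spine (suc i))
  ... | ‵inject₁ j = inj₁ (pendant i j)

  edge-hub : ∀ {u v} → Edge A u v → ∀ i → u ≡ hub i → ∃[ j ] v ≡ nb i j
  edge-hub (spine i′) i eq with refl ← inject₁-injective {i = i′} {suc i} (x-injective eq) =
    suc (fromℕ _) , lemma
    where
    lemma : x (suc (suc i)) ≡ nb i (suc (fromℕ _))
    lemma rewrite view-fromℕ (Vec.lookup A i) = refl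
  edge-hub (pendant i′ j) i eq with refl ← inject₁-injective (Fin.suc-injective (x-injective eq)) =
    suc (inject₁ j) , lemma
    where
    lemma : y i j ≡ nb i (suc (inject₁ j))
    lemma rewrite view-inject₁ j = refl

  edgeAt-hub : ∀ i {v} → EdgeAt (hub i) v → ∃[ j ] v ≡ nb i j
  edgeAt-hub i (inj₁ e)        = edge-hub e i refl
  edgeAt-hub i (inj₂ (eq , _)) = zero , eq

  edge-root : ∀ {u v} → Edge A u v → u ≡ x zero → v ≡ x (suc zero)
  edge-root (spine zero)    _ = refl

  edge-last : ∀ {u v} → Edge A u v → u ≢ x (suc (fromℕ k))
  edge-last (spine i) eq       = fromℕ≢inject₁ (sym (x-injective eq))
  edge-last (pendant i _) eq   = fromℕ≢inject₁ (sym (Fin.suc-injective (x-injective eq)))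

  edge-leaf : ∀ {u v i j} → Edge A u v → u ≢ y i j
  edge-leaf (spine _) ()
  edge-leaf (pendant _ _) ()

  -- Away from the hubs a vertex has a single edge, so properness and intervals need work only at
  -- the hubs.
  edgeAt-cases : ∀ u → (∃[ i ] u ≡ hub i) ⊎ (∃[ w ] ∀ v → EdgeAt u v ⇔ v ≡ w)
  edgeAt-cases (x zero) = inj₂ (x (suc zero) , λ v → mk⇔
    (λ { (inj₁ e) → edge-root e refl ; (inj₂ (_ , ≢)) → contradiction refl ≢ })
    (λ { refl → inj₁ (spine zero) }))
  edgeAt-cases (x (suc i)) with view i
  ... | ‵fromℕ = inj₂ (x (suc (fromℕ _)) , λ v → mk⇔
    (λ { (inj₁ e) → contradiction refl (edge-last e) ; (inj₂ (eq , _)) → eq })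
    (λ { refl → inj₂ (refl , λ ()) }))
  ... | ‵inject₁ i = inj₁ (i , refl)
  edgeAt-cases (y i j) = inj₂ (y i j , λ v → mk⇔
    (λ { (inj₁ e) → contradiction refl (edge-leaf e) ; (inj₂ (eq , _)) → eq })
    (λ { refl → inj₂ (refl , λ ()) }))

-- Numbering the edges of T[A]

-- Labels the spine edges: if the edge entering a hub has label c, the other
-- edges at the hub get c ⊕ 1, c ⊕ 2, …, the last one being the next spine edge.
-- With _+_ this numbers all edges consecutively; step m (below) keeps them ≤ m.
spineLabel : ∀ {k} → (ℕ → ℕ → ℕ) → ℕ → Vec ℕ k → Fin (suc k) → ℕ
spineLabel _⊕_ c A       zero    = c
spineLabel _⊕_ c (a ∷ A) (suc i) = spineLabel _⊕_ (c ⊕ suc a) A i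

-- The label of the edge from par v to v (junk value c at the root).
label : ∀ {k} → (ℕ → ℕ → ℕ) → ℕ → (A : Vec ℕ k) → Vertex A → ℕ
label _⊕_ c A (x zero)    = c
label _⊕_ c A (x (suc i)) = spineLabel _⊕_ c A i
label _⊕_ c A (y i j)     = spineLabel _⊕_ c A (inject₁ i) ⊕ suc (toℕ j)

spineLabel-suc : ∀ {k} _⊕_ c (A : Vec ℕ k) i →
                 spineLabel _⊕_ c A (suc i) ≡ spineLabel _⊕_ c A (inject₁ i) ⊕ suc (Vec.lookup A i)
spineLabel-suc _⊕_ c (a ∷ A) zero    = refl
spineLabel-suc _⊕_ c (a ∷ A) (suc i) = spineLabel-suc _⊕_ (c ⊕ suc a) A i

-- The position in `nb` is the summand. The premise serves position 0, whose label is `s` itself;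
-- for `step m` it amounts to s ≤ m.
label-nb : ∀ {k} _⊕_ c (A : Vec ℕ k) i → let s = spineLabel _⊕_ c A (inject₁ i) in
           s ⊕ 0 ≡ s → ∀ j → label _⊕_ c A (nb i j) ≡ s ⊕ toℕ j
label-nb _⊕_ c A i s⊕0 zero    = sym s⊕0
label-nb _⊕_ c A i s⊕0 (suc j) with view j
... | ‵fromℕ     = trans (spineLabel-suc _⊕_ c A i)
                         (cong (λ a → spineLabel _⊕_ c A (inject₁ i) ⊕ suc a) (sym (toℕ-fromℕ _)))
... | ‵inject₁ j = cong (λ a → spineLabel _⊕_ c A (inject₁ i) ⊕ suc a) (sym (toℕ-inject₁ j))

-- The number of edges of T[A]: the first spine edge, then for each hub its pendant edges and the
-- next spine edge.
size : ∀ {k} → Vec ℕ k → ℕ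
size []      = 1
size (a ∷ A) = suc a + size A

size>0 : ∀ {k} (A : Vec ℕ k) → 0 < size A
size>0 []      = s≤s z≤n
size>0 (a ∷ A) = s≤s z≤n

label≥ : ∀ {k} c (A : Vec ℕ k) v → c ≤ label _+_ c A v
label≥ c A       (x zero)          = ℕ.≤-refl
label≥ c A       (x (suc zero))    = ℕ.≤-refl
label≥ c (a ∷ A) (x (suc (suc i))) = ℕ.≤-trans (ℕ.m≤m+n c (suc a)) (label≥ (c + suc a) A (x (suc i)))
label≥ c (a ∷ A) (y zero j)        = ℕ.m≤m+n c _
label≥ c (a ∷ A) (y (suc i) j)     = ℕ.≤-trans (ℕ.m≤m+n c (suc a)) (label≥ (c + suc a) A (y i j))

label<size : ∀ {k} c (A : Vec ℕ k) v → label _+_ c A v < c + size A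
label<size c A       (x zero)          = ℕ.m<m+n c (size>0 A)
label<size c A       (x (suc zero))    = ℕ.m<m+n c (size>0 A)
label<size c (a ∷ A) (x (suc (suc i))) =
  ℕ.<-≤-trans (label<size (c + suc a) A (x (suc i))) (ℕ.≤-reflexive (ℕ.+-assoc c (suc a) (size A)))
label<size c (a ∷ A) (y zero j)        =
  ℕ.+-monoʳ-< c (s≤s (ℕ.<-≤-trans (toℕ<n j) (ℕ.m≤m+n a (size A))))
label<size c (a ∷ A) (y (suc i) j)     =
  ℕ.<-≤-trans (label<size (c + suc a) A (y i j)) (ℕ.≤-reflexive (ℕ.+-assoc c (suc a) (size A)))

shift : ∀ {k a} {A : Vec ℕ k} → Vertex A → Vertex (a ∷ A)
shift (x i)   = x (suc i)
shift (y i j) = y (suc i) j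

-- The view for induction on the vector. The shifted root is the first hub, which `first` covers, so
-- `later` excludes it.
data Shifted {k a} {A : Vec ℕ k} : Vertex (a ∷ A) → Set where
  root  : Shifted (x zero)
  first : Shifted (x (suc zero))
  leaf  : (j : Fin a) → Shifted (y zero j)
  later : (v : Vertex A) → v ≢ x zero → Shifted (shift v)

shifted : ∀ {k a} {A : Vec ℕ k} (v : Vertex (a ∷ A)) → Shifted v
shifted (x zero)          = root
shifted (x (suc zero))    = first
shifted (x (suc (suc i))) = later (x (suc i)) λ ()
shifted (y zero j)        = leaf j
shifted (y (suc i) j)     = later (y i j) λ ()

label-shift : ∀ {k} _⊕_ c a (A : Vec ℕ k) v → v ≢ x zero →
              label _⊕_ c (a ∷ A) (shift v) ≡ label _⊕_ (c ⊕ suc a) A v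
label-shift _⊕_ c a A (x zero)    v≢ = contradiction refl v≢
label-shift _⊕_ c a A (x (suc i)) _  = refl
label-shift _⊕_ c a A (y i j)     _  = refl

shift≥ : ∀ {k} c a (A : Vec ℕ k) v → v ≢ x zero → c + suc a ≤ label _+_ c (a ∷ A) (shift v)
shift≥ c a A v v≢ = ℕ.≤-trans (label≥ (c + suc a) A v) (ℕ.≤-reflexive (sym (label-shift _+_ c a A v v≢)))

-- The first spine edge and the pendant edges of the first hub have labels at most c + a, all
-- further edges at least c + suc a.
leaf<shift : ∀ {k} c a (A : Vec ℕ k) {j} v → v ≢ x zero → j ≤ a → c + j ≢ label _+_ c (a ∷ A) (shift v)
leaf<shift c a A v v≢ j≤a = ℕ.<⇒≢ (ℕ.<-≤-trans (ℕ.+-monoʳ-< c (s≤s j≤a)) (shift≥ c a A v v≢))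

label-injective : ∀ {k} c (A : Vec ℕ k) {v w} → v ≢ x zero → w ≢ x zero →
                  label _+_ c A v ≡ label _+_ c A w → v ≡ w
label-injective c [] {x zero}             v≢ w≢ eq = contradiction refl v≢
label-injective c [] {x (suc zero)} {x zero} v≢ w≢ eq = contradiction refl w≢
label-injective c [] {x (suc zero)} {x (suc zero)} v≢ w≢ eq = refl
label-injective c (a ∷ A) {v} {w} v≢ w≢ eq with shifted v | shifted w
... | root       | _          = contradiction refl v≢
... | first      | root       = contradiction refl w≢
... | first      | first      = refl
... | first      | leaf j     = contradiction eq (ℕ.m≢1+m+n c ∘ (λ p → trans p (ℕ.+-suc c _)))
... | first      | later w p  = contradiction (trans (ℕ.+-identityʳ c) eq) (leaf<shift c a A w p z≤n)
... | leaf i     | root       = contradiction refl w≢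
... | leaf i     | first      = contradiction (sym eq) (ℕ.m≢1+m+n c ∘ (λ p → trans p (ℕ.+-suc c _)))
... | leaf i     | leaf j     = cong (y zero) (toℕ-injective (ℕ.suc-injective (ℕ.+-cancelˡ-≡ c _ _ eq)))
... | leaf i     | later w p  = contradiction eq (leaf<shift c a A w p (toℕ<n i))
... | later v p  | root       = contradiction refl w≢
... | later v p  | first      = contradiction (trans (ℕ.+-identityʳ c) (sym eq)) (leaf<shift c a A v p z≤n)
... | later v p  | leaf j     = contradiction (sym eq) (leaf<shift c a A v p (toℕ<n j))
... | later v p  | later w q  = cong shift (label-injective (c + suc a) A p q
                                  (trans (sym (label-shift _+_ c a A v p)) (trans eq (label-shift _+_ c a A w q))))

-- Up to `m` the labels grow by true addition, so they meet c, c + 1, ... without gaps. Asking for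
-- agreement with `_+_` only up to `m` covers both `step m` and `_+_` itself.
label-surjective : ∀ {k} _⊕_ m → (∀ c j → c + j ≤ m → c ⊕ j ≡ c + j) →
                   ∀ c (A : Vec ℕ k) {γ} → c ≤ γ → γ ≤ m → γ < c + size A →
                   ∃[ v ] v ≢ x zero × label _⊕_ c A v ≡ γ
label-surjective _⊕_ m ⊕≡+ c [] c≤γ γ≤m γ< =
  x (suc zero) , (λ ()) , ℕ.≤-antisym c≤γ (ℕ.≤-pred (ℕ.≤-trans γ< (ℕ.≤-reflexive (ℕ.+-comm c 1))))
label-surjective _⊕_ m ⊕≡+ c (a ∷ A) {γ} c≤γ γ≤m γ< with ℕ.m≤n⇒∃[o]m+o≡n c≤γ
... | zero  , refl = x (suc zero) , (λ ()) , sym (ℕ.+-identityʳ c)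
... | suc j , refl with j ℕ.<? a
...   | yes j<a = y zero (fromℕ< j<a) , (λ ())
                , trans (cong (λ j → c ⊕ suc j) (toℕ-fromℕ< j<a)) (⊕≡+ c (suc j) γ≤m)
...   | no  j≮a = let v , v≢ , eq = rec in shift v , shift≢ v , trans (label-shift _⊕_ c a A v v≢) eq
  where
  c′≤ : c + suc a ≤ c + suc j
  c′≤ = ℕ.+-monoʳ-≤ c (s≤s (ℕ.≮⇒≥ j≮a))
  c′≡ : c ⊕ suc a ≡ c + suc a
  c′≡ = ⊕≡+ c (suc a) (ℕ.≤-trans c′≤ γ≤m)
  rec : ∃[ v ] v ≢ x zero × label _⊕_ (c ⊕ suc a) A v ≡ c + suc j
  rec rewrite c′≡ = label-surjective _⊕_ m ⊕≡+ (c + suc a) A c′≤ γ≤m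
    (ℕ.<-≤-trans γ< (ℕ.≤-reflexive (sym (ℕ.+-assoc c (suc a) (size A)))))
  shift≢ : ∀ v → shift {a = a} {A} v ≢ x zero
  shift≢ (x _)   ()
  shift≢ (y _ _) ()

-- The folded progression c, c + 1, ..., m, c - 1, c - 2, ...

-- The first j with c + j > m is m + 1 - c, so m ∸ j continues with c - 1.
step : ℕ → ℕ → ℕ → ℕ
step m c j with c + j ≤? m
... | yes _ = c + j
... | no  _ = m ∸ j

step-+ : ∀ m c j → c + j ≤ m → step m c j ≡ c + j
step-+ m c j p with c + j ≤? m
... | yes _ = refl
... | no ¬p = contradiction p ¬p

step-∸ : ∀ m c j → m < c + j → step m c j ≡ m ∸ j
step-∸ m c j p with c + j ≤? m
... | yes q = contradiction p (ℕ.≤⇒≯ q)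
... | no  _ = refl

step≤ : ∀ m c j → step m c j ≤ m
step≤ m c j with c + j ≤? m
... | yes p = p
... | no  _ = ℕ.m∸n≤m m j

m∸j<c : ∀ {m c j} → j ≤ m → m < c + j → m ∸ j < c
m∸j<c {m} {c} {j} j≤m m< = ℕ.+-cancelʳ-< j (m ∸ j) c (subst (_< c + j) (sym (ℕ.m∸n+n≡m j≤m)) m<)

-- Rising values are at least c and falling ones below c, so the two branches cannot meet; i, j ≤ m
-- keeps `_∸_` from truncating.
step-injective : ∀ m c {i j} → i ≤ m → j ≤ m → step m c i ≡ step m c j → i ≡ j
step-injective m c {i} {j} i≤m j≤m eq with c + i ≤? m | c + j ≤? m
... | yes _ | yes _ = ℕ.+-cancelˡ-≡ c i j eq
... | yes _ | no ¬p = contradiction (ℕ.m≤m+n c i) (ℕ.<⇒≱ (subst (_< c) (sym eq) (m∸j<c j≤m (ℕ.≰⇒> ¬p))))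
... | no ¬p | yes _ = contradiction (ℕ.m≤m+n c j) (ℕ.<⇒≱ (subst (_< c) eq (m∸j<c i≤m (ℕ.≰⇒> ¬p))))
... | no  _ | no  _ = ℕ.∸-cancelˡ-≡ i≤m j≤m eq

ℕInterval : ℕ → (ℕ → Set) → Set
ℕInterval m P = ∃₂ λ lo hi → lo ≤ hi × hi ≤ m × ∀ γ → P γ ⇔ (lo ≤ γ × γ ≤ hi)

-- If c + d ≤ m, the values are c, ..., c + d. Otherwise the rise fills c, ..., m and the fall
-- continues from c - 1 down to m - d.
step-interval : ∀ m c d → c ≤ m → d ≤ m → ℕInterval m (λ γ → ∃[ j ] j ≤ d × step m c j ≡ γ)
step-interval m c d c≤m d≤m with c + d ≤? m
... | yes c+d≤m = c , c + d , ℕ.m≤m+n c d , c+d≤m , λ γ → mk⇔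
  (λ { (j , j≤d , refl) → subst (λ z → c ≤ z × z ≤ c + d)
         (sym (step-+ m c j (ℕ.≤-trans (ℕ.+-monoʳ-≤ c j≤d) c+d≤m)))
         (ℕ.m≤m+n c j , ℕ.+-monoʳ-≤ c j≤d) })
  (λ { (c≤γ , γ≤) → up c≤γ γ≤ })
  where
  up : ∀ {γ} → c ≤ γ → γ ≤ c + d → ∃[ j ] j ≤ d × step m c j ≡ γ
  up c≤γ γ≤ with ℕ.m≤n⇒∃[o]m+o≡n c≤γ
  ... | j , refl = j , ℕ.+-cancelˡ-≤ c j d γ≤ , step-+ m c j (ℕ.≤-trans γ≤ c+d≤m)
... | no c+d≰m = m ∸ d , m , ℕ.m∸n≤m m d , ℕ.≤-refl , λ γ → mk⇔
  (λ { (j , j≤d , refl) → below j j≤d , step≤ m c j })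
  (λ { (p , q) → down p q })
  where
  m<c+d = ℕ.≰⇒> c+d≰m
  below : ∀ j → j ≤ d → m ∸ d ≤ step m c j
  below j j≤d with c + j ≤? m
  ... | yes _ = ℕ.≤-trans (ℕ.<⇒≤ (m∸j<c d≤m m<c+d)) (ℕ.m≤m+n c j)
  ... | no  _ = ℕ.∸-monoʳ-≤ m j≤d
  down : ∀ {γ} → m ∸ d ≤ γ → γ ≤ m → ∃[ j ] j ≤ d × step m c j ≡ γ
  down {γ} p q with c ≤? γ
  ... | yes c≤γ with ℕ.m≤n⇒∃[o]m+o≡n c≤γ
  ...   | j , refl = j , ℕ.<⇒≤ (ℕ.+-cancelˡ-< c j d (ℕ.≤-<-trans q m<c+d)) , step-+ m c j q
  -- A value below c lies on the falling branch, where m ∸ j ≡ γ is solved by j = m ∸ γ.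
  down {γ} p q | no c≰γ = m ∸ γ
    , subst (m ∸ γ ≤_) (ℕ.m∸[m∸n]≡n d≤m) (ℕ.∸-monoʳ-≤ m p)
    , trans (step-∸ m c (m ∸ γ) m<) (ℕ.m∸[m∸n]≡n q)
    where
    m< : m < c + (m ∸ γ)
    m< = subst (_< c + (m ∸ γ)) (ℕ.m+[n∸m]≡n q) (ℕ.+-monoˡ-< (m ∸ γ) (ℕ.≰⇒> c≰γ))

spineLabel-step≤ : ∀ {k} m c (A : Vec ℕ k) i → c ≤ m → spineLabel (step m) c A i ≤ m
spineLabel-step≤ m c A       zero    c≤m = c≤m
spineLabel-step≤ m c (a ∷ A) (suc i) c≤m = spineLabel-step≤ m (step m c (suc a)) A i (step≤ m c (suc a))

label-step≤ : ∀ {k} m c (A : Vec ℕ k) v → c ≤ m → label (step m) c A v ≤ m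
label-step≤ m c A (x zero)    c≤m = c≤m
label-step≤ m c A (x (suc i)) c≤m = spineLabel-step≤ m c A i c≤m
label-step≤ m c A (y i j)     c≤m = step≤ m (spineLabel (step m) c A (inject₁ i)) (suc (toℕ j))

-- Under the plain numbering by `_+_` the label at position j is a constant plus j, and the constant
-- cancels.
nb-injective : ∀ {k} {A : Vec ℕ k} i {j j′} → nb {A = A} i j ≡ nb i j′ → j ≡ j′
nb-injective {A = A} i {j} {j′} eq = toℕ-injective (ℕ.+-cancelˡ-≡ _ (toℕ j) (toℕ j′)
  (trans (sym (label-nb _+_ 0 A i (ℕ.+-identityʳ _) j))
         (trans (cong (label _+_ 0 A) eq) (label-nb _+_ 0 A i (ℕ.+-identityʳ _) j′))))

-- The interval coloring of T[A] with m + 1 colors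

module StepColoring {k} (A : Vec ℕ k) (m : ℕ) (deg : ∀ i → suc (Vec.lookup A i) ≤ m) where

  κ : Vertex A → ℕ
  κ = label (step m) 0 A

  κ≤ : ∀ v → κ v ≤ m
  κ≤ v = label-step≤ m 0 A v z≤n

  σ : Fin k → ℕ
  σ i = spineLabel (step m) 0 A (inject₁ i)

  σ≤ : ∀ i → σ i ≤ m
  σ≤ i = spineLabel-step≤ m 0 A (inject₁ i) z≤n

  κ-nb : ∀ i j → κ (nb i j) ≡ step m (σ i) (toℕ j)
  κ-nb i = label-nb (step m) 0 A i
    (trans (step-+ m (σ i) 0 (subst (_≤ m) (sym (ℕ.+-identityʳ (σ i))) (σ≤ i))) (ℕ.+-identityʳ (σ i)))

  -- Positions at a hub end at suc a; `deg`, which bounds the degree 2 + a by the number m + 1 of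
  -- colors, keeps them in the range where `step` is injective.
  nb≤ : ∀ i (j : Fin (2 + Vec.lookup A i)) → toℕ j ≤ m
  nb≤ i j = ℕ.≤-trans (ℕ.≤-pred (toℕ<n j)) (deg i)

  κ-proper : ∀ {u v w} → EdgeAt u v → EdgeAt u w → κ v ≡ κ w → v ≡ w
  κ-proper {u} sv sw eq with edgeAt-cases u
  ... | inj₂ (_ , only) = trans (Equivalence.to (only _) sv) (sym (Equivalence.to (only _) sw))
  ... | inj₁ (i , refl) with edgeAt-hub i sv | edgeAt-hub i sw
  ...   | j , refl | j′ , refl = cong (nb i) (toℕ-injective (step-injective m (σ i) (nb≤ i j) (nb≤ i j′)
                                   (trans (sym (κ-nb i j)) (trans eq (κ-nb i j′)))))

  κ-interval : ∀ u → ℕInterval m (λ γ → ∃[ v ] EdgeAt u v × κ v ≡ γ)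
  κ-interval u with edgeAt-cases u
  ... | inj₂ (w , only) = κ w , κ w , ℕ.≤-refl , κ≤ w , λ γ → mk⇔
    (λ { (v , sv , refl) → let eq = cong κ (Equivalence.to (only v) sv) in ℕ.≤-reflexive (sym eq) , ℕ.≤-reflexive eq })
    (λ { (p , q) → w , Equivalence.from (only w) refl , ℕ.≤-antisym p q })
  ... | inj₁ (i , refl)
    with step-interval m (σ i) (suc (Vec.lookup A i))
                       (σ≤ i) (deg i)
  ...   | lo , hi , lo≤hi , hi≤m , iff = lo , hi , lo≤hi , hi≤m , λ γ → mk⇔
    (λ { (v , sv , refl) → Equivalence.to (iff _) (out v sv) })
    (λ p → back (Equivalence.from (iff γ) p))
    where
    out : ∀ v → EdgeAt (hub i) v → ∃[ j ] j ≤ suc (Vec.lookup A i) × step m (σ i) j ≡ κ v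
    out v sv with edgeAt-hub i sv
    ... | j , refl = toℕ j , ℕ.≤-pred (toℕ<n j) , sym (κ-nb i j)
    back : ∀ {γ} → (∃[ j ] j ≤ suc (Vec.lookup A i) × step m (σ i) j ≡ γ) →
           ∃[ v ] EdgeAt (hub i) v × κ v ≡ γ
    back (j , j≤ , refl) = nb i j′ , nb-edgeAt i j′ , trans (κ-nb i j′) (cong (step m (σ i)) (toℕ-fromℕ< (s≤s j≤)))
      where j′ = fromℕ< (s≤s j≤)

  κ-surjective : m < size A → ∀ {γ} → γ ≤ m → ∃[ v ] v ≢ x zero × κ v ≡ γ
  κ-surjective m< γ≤ = label-surjective (step m) m (step-+ m) 0 A z≤n γ≤ (ℕ.≤-<-trans γ≤ m<)

-- The maximum degree of T[A], which turns out to be the chromatic index.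
Δ : ∀ {k} → Vec ℕ k → ℕ
Δ []      = 1
Δ (a ∷ A) = (2 + a) ⊔ Δ A

Δ≤ : ∀ {k} (A : Vec ℕ k) {t} → 1 ≤ t → (∀ i → 2 + Vec.lookup A i ≤ t) → Δ A ≤ t
Δ≤ []      1≤t deg = 1≤t
Δ≤ (a ∷ A) 1≤t deg = ℕ.⊔-lub (deg zero) (Δ≤ A 1≤t (deg ∘ suc))

degree≤Δ : ∀ {k} (A : Vec ℕ k) i → 2 + Vec.lookup A i ≤ Δ A
degree≤Δ (a ∷ A) zero    = ℕ.m≤m⊔n (2 + a) (Δ A)
degree≤Δ (a ∷ A) (suc i) = ℕ.≤-trans (degree≤Δ A i) (ℕ.m≤n⊔m (2 + a) (Δ A))

1≤Δ : ∀ {k} (A : Vec ℕ k) → 1 ≤ Δ A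
1≤Δ []      = ℕ.≤-refl
1≤Δ (a ∷ A) = ℕ.≤-trans (1≤Δ A) (ℕ.m≤n⊔m (2 + a) (Δ A))

-- Interval colorings of graphs isomorphic to T[A]

module _ {G : Graph} where
  open Graph G

  f≤∣V∣ : ∀ {t} (φ : α G t) → f φ ≤ ∣V∣
  f≤∣V∣ φ = ℕ.≤-trans (List.length-filter (λ x → isInterval? (S? φ x)) (allFin ∣V∣))
                      (ℕ.≤-reflexive (List.length-tabulate id))

  all-intervals : ∀ {t} (φ : α G t) → (∀ w → IsInterval (S φ w)) → f φ ≡ ∣V∣
  all-intervals φ int =
    trans (cong length (List.filter-all (λ x → isInterval? (S? φ x)) {allFin ∣V∣} (All.tabulate λ {w} _ → int w)))
          (List.length-tabulate {n = ∣V∣} id)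

color-injectiveAt : ∀ {G t} (φ : α G t) {w e e′} → Graph.IncidentWith G w e → Graph.IncidentWith G w e′ →
                    α.color φ e ≡ α.color φ e′ → e ≡ e′
color-injectiveAt φ {w} {e} {e′} w∈e w∈e′ eq with e Fin.≟ e′
... | yes e≡e′ = e≡e′
... | no  e≢e′ = contradiction eq (α.proper φ (e≢e′ , w , w∈e , w∈e′))

-- Shows that |E| colors suffice: this gives `Δ≤∣E∣` and, in the converse, a value of f from which
-- the search for the maximum can start.
identityColoring : ∀ G → α G (Graph.∣E∣ G)
identityColoring G = record
  { color = id ; proper = proj₁ ; surjective = λ c → c , id }

module Caterpillar {G : Graph} {k} (A : Vec ℕ k) (iso : Isomorphism (Graph._~_ G) (Adjacent A)) where
  open Graph G
  open Isomorphism iso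

  to-from : ∀ v → to (from v) ≡ v
  to-from = Inverse.strictlyInverseˡ bijection

  from-to : ∀ v → from (to v) ≡ v
  from-to = Inverse.strictlyInverseʳ bijection

  lowerEnd : ∀ e → ∃[ v ] v ≢ x zero × Joins G (from (par v)) (from v) e
  lowerEnd e with someEnds {G} e
  ... | u , v , j with Equivalence.to (adjacency u v) (joins⇒~ {G} j)
  ...   | fwd uv = to v , edge-nonroot uv
                 , subst₂ (λ a b → Joins G a b e) (trans (sym (from-to u)) (cong from (edge-par uv))) (sym (from-to v)) j
  ...   | bwd vu = to u , edge-nonroot vu
                 , subst₂ (λ a b → Joins G a b e) (trans (sym (from-to v)) (cong from (edge-par vu))) (sym (from-to u)) (joins-sym {G} j)

  child : E → Vertex A
  child = proj₁ ∘ lowerEnd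

  child-nonroot : ∀ e → child e ≢ x zero
  child-nonroot = proj₁ ∘ proj₂ ∘ lowerEnd

  child-joins : ∀ e → Joins G (from (par (child e))) (from (child e)) e
  child-joins = proj₂ ∘ proj₂ ∘ lowerEnd

  child-injective : ∀ {e e′} → child e ≡ child e′ → e ≡ e′
  child-injective {e} {e′} eq = joins-unique {G} (child-joins e)
    (subst (λ v → Joins G (from (par v)) (from v) e′) (sym eq) (child-joins e′))

  incident⇒edgeAt : ∀ {w e} → IncidentWith w e → EdgeAt (to w) (child e)
  incident⇒edgeAt {w} {e} w∈e with joins-incident {G} (child-joins e) w∈e
  ... | inj₁ refl = inj₁ (subst (λ u → Edge A u (child e)) (sym (to-from _)) (par-edge (child-nonroot e)))
  ... | inj₂ refl = inj₂ (sym (to-from _) , child-nonroot e ∘ trans (sym (to-from _)))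

  edgeAt⇒incident : ∀ {w e} → EdgeAt (to w) (child e) → IncidentWith w e
  edgeAt⇒incident {w} {e} (inj₁ uv) =
    subst (λ u → IncidentWith u e) (trans (cong from (sym (edge-par uv))) (from-to w)) (proj₁ (child-joins e))
  edgeAt⇒incident {w} {e} (inj₂ (eq , _)) =
    subst (λ u → IncidentWith u e) (trans (cong from eq) (from-to w)) (proj₁ (proj₂ (child-joins e)))

  -- The edge of G between v and its parent is incident with both, so it could be named differently
  -- only if v were its own parent or the parent of its parent; `edge-asym` excludes both.
  child-surjective : ∀ {v} → v ≢ x zero → ∃[ e ] child e ≡ v
  child-surjective {v} v≢ with edge-of {G} (Equivalence.from (adjacency (from (par v)) (from v))
      (subst₂ (Adjacent A) (sym (to-from _)) (sym (to-from _)) (fwd (par-edge v≢))))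
  ... | e , p∈e , v∈e , _ with incident⇒edgeAt v∈e
  ...   | inj₂ (eq , _) = e , trans eq (to-from v)
  ...   | inj₁ vc with incident⇒edgeAt p∈e
  ...     | inj₁ pc = contradiction (subst (λ p → Edge A p v) (sym v≡p) (par-edge v≢))
                                    (λ vv → edge-asym vv vv)
    where
    v≡p : v ≡ par v
    v≡p = trans (sym (to-from v)) (trans (trans (edge-par vc) (sym (edge-par pc))) (to-from (par v)))
  ...     | inj₂ (eq , _) = contradiction
    (subst₂ (Edge A) (to-from v) (trans eq (to-from (par v))) vc) (edge-asym (par-edge v≢))

  edgeAt-nonroot : ∀ {u v : Vertex A} → EdgeAt u v → v ≢ x zero
  edgeAt-nonroot (inj₁ uv)         = edge-nonroot uv
  edgeAt-nonroot (inj₂ (refl , ≢)) = ≢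

  module _ (m : ℕ) (deg : ∀ i → suc (Vec.lookup A i) ≤ m) (m< : m < size A) where
    open StepColoring A m deg

    private
      color : E → Fin (suc m)
      color e = fromℕ< (s≤s (κ≤ (child e)))

      toℕ-color : ∀ e → toℕ (color e) ≡ κ (child e)
      toℕ-color e = toℕ-fromℕ< (s≤s (κ≤ (child e)))

    stepColoring : α G (suc m)
    stepColoring = record
      { color = color
      ; proper = λ {e} {e′} (e≢e′ , w , w∈e , w∈e′) eq → e≢e′ (child-injective
          (κ-proper (incident⇒edgeAt w∈e) (incident⇒edgeAt w∈e′)
            (trans (sym (toℕ-color e)) (trans (cong toℕ eq) (toℕ-color e′)))))
      ; surjective = surjective
      }
      where
      surjective : Surjective _≡_ _≡_ color
      surjective c with κ-surjective m< (ℕ.≤-pred (toℕ<n c))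
      ... | v , v≢ , eq with child-surjective v≢
      ...   | e , refl = e , λ { refl → toℕ-injective (trans (toℕ-color e) eq) }

    stepColoring-interval : ∀ w → IsInterval (S stepColoring w)
    stepColoring-interval w with κ-interval (to w)
    ... | lo , hi , lo≤hi , hi≤m , iff = a , b , subst₂ _≤_ (sym ta) (sym tb) lo≤hi , λ c → mk⇔
      (λ { (e , w∈e , refl) → let p , q = Equivalence.to (iff _) (child e , incident⇒edgeAt w∈e , sym (toℕ-color e))
                              in subst (_≤ _) (sym ta) p , subst (_ ≤_) (sym tb) q })
      (λ (p , q) → back c (Equivalence.from (iff (toℕ c)) (subst (_≤ _) ta p , subst (_ ≤_) tb q)))
      where
      lo< = s≤s (ℕ.≤-trans lo≤hi hi≤m)
      a = fromℕ< lo<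
      b = fromℕ< (s≤s hi≤m)
      ta = toℕ-fromℕ< lo<
      tb = toℕ-fromℕ< (s≤s hi≤m)
      back : ∀ c → (∃[ v ] EdgeAt (to w) v × κ v ≡ toℕ c) → S stepColoring w c
      back c (v , sv , eq) with child-surjective (edgeAt-nonroot sv)
      ... | e , refl = e , edgeAt⇒incident sv , toℕ-injective (trans (toℕ-color e) eq)

  -- The 2 + a edges at a hub receive distinct colors under any proper coloring.
  degree≤ : ∀ {t} → α G t → ∀ i → 2 + Vec.lookup A i ≤ t
  degree≤ {t} φ i = Fin.injective⇒≤ inj
    where
    open α φ
    nbEdge : ∀ j → ∃[ e ] child e ≡ nb {A = A} i j
    nbEdge j = child-surjective (edgeAt-nonroot (nb-edgeAt {A = A} i j))
    incident : ∀ j → IncidentWith (from (hub {A = A} i)) (proj₁ (nbEdge j))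
    incident j = edgeAt⇒incident (subst₂ EdgeAt (sym (to-from (hub {A = A} i))) (sym (proj₂ (nbEdge j))) (nb-edgeAt {A = A} i j))
    inj : Injective _≡_ _≡_ (λ j → color (proj₁ (nbEdge j)))
    inj {j} {j′} eq = nb-injective {A = A} i
      (trans (sym (proj₂ (nbEdge j)))
             (trans (cong child (color-injectiveAt φ (incident j) (incident j′) eq)) (proj₂ (nbEdge j′))))

  -- The consecutive numbering embeds the edges into the numbers below `size A`. This turns t ≤ |E|
  -- into the bound under which `κ-surjective` uses every color.
  ∣E∣≤size : ∣E∣ ≤ size A
  ∣E∣≤size = Fin.injective⇒≤ {f = λ e → fromℕ< (label<size 0 A (child e))} λ {e} {e′} eq →
    child-injective (label-injective 0 A (child-nonroot e) (child-nonroot e′)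
      (trans (sym (toℕ-fromℕ< (label<size 0 A (child e)))) (trans (cong toℕ eq) (toℕ-fromℕ< (label<size 0 A (child e′))))))

  someColor : ∀ {t} → α G t → 1 ≤ t
  someColor φ = ℕ.≤-<-trans z≤n (toℕ<n (α.color φ (proj₁ (child-surjective {x (suc zero)} λ ()))))

  Δ≤colors : ∀ {t} → α G t → Δ A ≤ t
  Δ≤colors φ = Δ≤ A (someColor φ) (degree≤ φ)

  intervalColoring : ∀ {t} → Δ A ≤ t → t ≤ ∣E∣ → ∃[ φ ] f {G} {t} φ ≡ ∣V∣
  intervalColoring {zero}  Δ≤t _   = contradiction (ℕ.≤-trans (1≤Δ A) Δ≤t) λ ()
  intervalColoring {suc m} Δ≤t t≤E = φ , all-intervals φ (stepColoring-interval m deg m<)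
    where
    deg : ∀ i → suc (Vec.lookup A i) ≤ m
    deg i = ℕ.≤-pred (ℕ.≤-trans (degree≤Δ A i) Δ≤t)
    m< = ℕ.≤-trans t≤E ∣E∣≤size
    φ = stepColoring m deg m<

  Δ≤∣E∣ : Δ A ≤ ∣E∣
  Δ≤∣E∣ = Δ≤colors (identityColoring G)

  μ₂≡∣V∣ : ∀ {t} → Admissible G t → μ₂[ G , t ]≡ ∣V∣
  μ₂≡∣V∣ ((k , (φ , _) , k≤t) , t≤E) =
    intervalColoring (ℕ.≤-trans (Δ≤colors φ) k≤t) t≤E , λ { (φ , refl) → f≤∣V∣ φ }

  -- The chromatic index is `Δ A`: the step coloring attains it, and the edges at a vertex of
  -- maximum degree rule out fewer colors.
  ∣E∣-admissible : Admissible G ∣E∣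
  ∣E∣-admissible = (Δ A , (proj₁ (intervalColoring ℕ.≤-refl Δ≤∣E∣) , Δ≤colors) , Δ≤∣E∣) , ℕ.≤-refl

  μ₂₁≡∣V∣ : μ₂₁[ G ]≡ ∣V∣
  μ₂₁≡∣V∣ = (∣E∣ , ∣E∣-admissible , μ₂≡∣V∣ ∣E∣-admissible) ,
    λ (t , adm , _ , greatest) → greatest (proj₁ (μ₂≡∣V∣ adm))

-- Unrolling an interval bijection along a spine

root? : ∀ {k} {A : Vec ℕ k} (v : Vertex A) → Dec (v ≡ x zero)
root? (x zero)    = yes refl
root? (x (suc _)) = no λ ()
root? (y _ _)     = no λ ()

module _ (G : Graph) where
  open Graph G

  ColorsAt : (E → Fin ∣E∣) → V → Fin ∣E∣ → Set
  ColorsAt color w c = ∃[ e ] (IncidentWith w e × color e ≡ c)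

  -- Stated for a bare function instead of `α G ∣E∣`, so that existence can be decided by searching
  -- all functions; properness is part of injectivity.
  IsIntervalBijection : (E → Fin ∣E∣) → Set
  IsIntervalBijection color =
    (∀ e e′ → color e ≡ color e′ → e ≡ e′) × (∀ c → ∃[ e ] color e ≡ c) × (∀ w → IsInterval (ColorsAt color w))

module FromBijection (G : Graph) (connected : Graph.Connected G)
                     (color : Graph.E G → Fin (Graph.∣E∣ G)) (good : IsIntervalBijection G color) where
  open Graph G

  private
    m : ℕ
    m = ∣E∣

    col : E → ℕ
    col e = toℕ (color e)

    col-injective : ∀ {e e′} → col e ≡ col e′ → e ≡ e′
    col-injective eq = proj₁ good _ _ (toℕ-injective eq)

    col-surjective : ∀ {γ} → γ < m → ∃[ e ] col e ≡ γ
    col-surjective γ<m = let e , eq = proj₁ (proj₂ good) (fromℕ< γ<m) in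
      e , trans (cong toℕ eq) (toℕ-fromℕ< γ<m)

    interval : ∀ w → IsInterval (ColorsAt G color w)
    interval = proj₂ (proj₂ good)

    lo hi : V → ℕ
    lo w = toℕ (proj₁ (interval w))
    hi w = toℕ (proj₁ (proj₂ (interval w)))

    Has : V → ℕ → Set
    Has w γ = ∃[ e ] (IncidentWith w e × col e ≡ γ)

    incident-bounds : ∀ {w e} → IncidentWith w e → lo w ≤ col e × col e ≤ hi w
    incident-bounds {w} {e} w∈e =
      Equivalence.to (proj₂ (proj₂ (proj₂ (interval w))) (color e)) (e , w∈e , refl)

    has : ∀ {w γ} → lo w ≤ γ → γ ≤ hi w → Has w γ
    has {w} {γ} lo≤γ γ≤hi =
      let γ<m = ℕ.≤-<-trans γ≤hi (toℕ<n (proj₁ (proj₂ (interval w))))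
          eq  = toℕ-fromℕ< γ<m
          e , w∈e , ce = Equivalence.from (proj₂ (proj₂ (proj₂ (interval w))) (fromℕ< γ<m))
                           (subst (lo w ≤_) (sym eq) lo≤γ , subst (_≤ hi w) (sym eq) γ≤hi)
      in e , w∈e , trans (cong toℕ ce) eq

    lo≤hi : ∀ w → lo w ≤ hi w
    lo≤hi w = proj₁ (proj₂ (proj₂ (interval w)))

    -- Each color occurs on one edge only, so a color seen at both ends of e belongs to an edge
    -- joining them, which is e.
    common-color : ∀ {u v e γ} → Joins G u v e → Has u γ → Has v γ → col e ≡ γ
    common-color j@(_ , _ , u≢v) (e₁ , u∈e₁ , refl) (e₂ , v∈e₂ , eq) with refl ← col-injective eq =
      cong col (joins-unique {G} j (u∈e₁ , v∈e₂ , u≢v))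

    -- A discrete intermediate value argument: if all colors at u are at most γ, so is the color of
    -- the edge to the next vertex of the walk, which therefore again has lo ≤ γ.
    crossing : ∀ {γ u v} → lo u ≤ γ → Star _~_ u v → γ < hi v → ∃[ w ] (lo w ≤ γ × γ < hi w)
    crossing lo≤γ ε γ<hi = _ , lo≤γ , γ<hi
    crossing {γ} {u} lo≤γ (u~w ◅ path) γ<hi with γ <? hi u
    ... | yes γ<hiu = u , lo≤γ , γ<hiu
    ... | no  γ≮hiu = let e , u∈e , w∈e , _ = edge-of {G} u~w in
      crossing (ℕ.≤-trans (proj₁ (incident-bounds w∈e))
                          (ℕ.≤-trans (proj₂ (incident-bounds u∈e)) (ℕ.≮⇒≥ γ≮hiu))) path γ<hi

    -- Apply `crossing` to a walk from an end of the edge of color γ to an end of the edge of color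
    -- γ + 1.
    consecutive : ∀ {γ} → suc γ < m → ∃[ w ] (Has w γ × γ < hi w)
    consecutive {γ} 1+γ<m =
      let e , ce       = col-surjective (ℕ.<-trans ℕ.≤-refl 1+γ<m)
          e′ , ce′     = col-surjective 1+γ<m
          u , _ , j    = someEnds {G} e
          v , _ , j′   = someEnds {G} e′
          w , lo≤ , <hi = crossing (subst (lo u ≤_) ce (proj₁ (incident-bounds (proj₁ j)))) (connected u v)
                                   (subst (_≤ hi v) ce′ (proj₂ (incident-bounds (proj₁ j′))))
      in w , has lo≤ (ℕ.<⇒≤ <hi) , <hi

    -- The smallest color is recorded because it identifies the vertex: injectivity of `place` rests
    -- on it.
    Spoke : V → ℕ → V → Set
    Spoke p δ v = (∃[ e ] (Joins G p v e × col e ≡ δ)) × lo v ≡ δ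

    -- If the far end v had a color below suc δ, it would also have δ. Then δ would occur at both
    -- ends of an edge of color suc δ, against `common-color`.
    spoke : ∀ {p δ} → lo p ≤ δ → suc δ ≤ hi p → ∃ (Spoke p (suc δ))
    spoke {p} {δ} lo≤δ δ<hi with has (ℕ.m≤n⇒m≤1+n lo≤δ) δ<hi
    ... | e , p∈e , ce with otherEnd {G} p∈e
    ...   | v , j = v , (e , j , ce) , ℕ.≤-antisym lov≤ (ℕ.≮⇒≥ lov≮)
      where
      lov≤ : lo v ≤ suc δ
      lov≤ = subst (lo v ≤_) ce (proj₁ (incident-bounds (proj₁ (proj₂ j))))
      δ<hiv : suc δ ≤ hi v
      δ<hiv = subst (_≤ hi v) ce (proj₂ (incident-bounds (proj₁ (proj₂ j))))
      lov≮ : ¬ (lo v < suc δ)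
      lov≮ (s≤s lov≤δ) = ℕ.1+n≢n (trans (sym ce)
        (common-color j (has lo≤δ (ℕ.<⇒≤ δ<hi)) (has lov≤δ (ℕ.<⇒≤ δ<hiv))))

  -- A copy of T[A] in G, entered through the edge from q to p of color c, whose
  -- edges are those of color ≥ c in the order of their labels.
  record Layout (c : ℕ) (q p : V) : Set where
    field
      {len}      : ℕ
      A          : Vec ℕ len
      place      : Vertex A → V
      place-root : place (x zero) ≡ q
      place-next : place (x (suc zero)) ≡ p
      place-edge : ∀ {u v} → Edge A u v → ∃[ e ] (Joins G (place u) (place v) e × col e ≡ label _+_ c A v)
      place-lo   : ∀ {v} → v ≢ x zero → lo (place v) ≡ label _+_ c A v
      total      : c + size A ≡ m

  private
    -- The new first hub is p. Its smallest color c is on the edge from q, its largest on the edge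
    -- entering the old layout, and the `a` colors in between lead to leaves.
    extend : ∀ {c q p e} a {p′} → Joins G q p e → col e ≡ c → lo p ≡ c → hi p ≡ c + suc a →
             Layout (c + suc a) p p′ → Layout c q p
    extend {c} {q} {p} {e} a j ce lop hip L = record
      { A          = a ∷ A
      ; place      = place⁺
      ; place-root = refl
      ; place-next = place-root
      ; place-edge = place-edge⁺
      ; place-lo   = place-lo⁺
      ; total      = trans (sym (ℕ.+-assoc c (suc a) (size A))) total
      }
      where
      open Layout L
      leafSpoke : (j : Fin a) → ∃ (Spoke p (suc (c + toℕ j)))
      leafSpoke j = spoke (subst (_≤ c + toℕ j) (sym lop) (ℕ.m≤m+n c (toℕ j)))
        (subst (suc (c + toℕ j) ≤_) (sym hip) (ℕ.+-monoʳ-< c (ℕ.m≤n⇒m≤1+n (toℕ<n j))))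

      place⁺ : Vertex (a ∷ A) → V
      place⁺ (x zero)      = q
      place⁺ (x (suc i))   = place (x i)
      place⁺ (y zero j)    = proj₁ (leafSpoke j)
      place⁺ (y (suc i) j) = place (y i j)

      place-edge⁺ : ∀ {u v} → Edge (a ∷ A) u v →
                    ∃[ e ] (Joins G (place⁺ u) (place⁺ v) e × col e ≡ label _+_ c (a ∷ A) v)
      place-edge⁺ (spine zero)        = e , subst (λ p → Joins G q p e) (sym place-root) j , ce
      place-edge⁺ (spine (suc i))     = place-edge (spine i)
      place-edge⁺ (pendant zero j)    = let v , (e , pv , ce) , _ = leafSpoke j in
        e , subst (λ p → Joins G p v e) (sym place-root) pv , trans ce (sym (ℕ.+-suc c (toℕ j)))
      place-edge⁺ (pendant (suc i) j) = place-edge (pendant i j)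

      place-lo⁺ : ∀ {v} → v ≢ x zero → lo (place⁺ v) ≡ label _+_ c (a ∷ A) v
      place-lo⁺ {x zero}          v≢ = contradiction refl v≢
      place-lo⁺ {x (suc zero)}    _  = trans (cong lo place-root) lop
      place-lo⁺ {x (suc (suc i))} _  = place-lo {x (suc i)} λ ()
      place-lo⁺ {y zero j}        _  = trans (proj₂ (proj₂ (leafSpoke j))) (sym (ℕ.+-suc c (toℕ j)))
      place-lo⁺ {y (suc i) j}     _  = place-lo {y i j} λ ()

    single : ∀ {c q p e} → Joins G q p e → col e ≡ c → lo p ≡ c → suc c ≡ m → Layout c q p
    single {c} {q} {p} {e} j ce lop 1+c≡m = record
      { A          = []
      ; place      = λ { (x zero) → q ; (x (suc zero)) → p }
      ; place-root = refl
      ; place-next = refl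
      ; place-edge = λ { (spine zero) → e , j , ce }
      ; place-lo   = λ { {x zero} v≢ → contradiction refl v≢ ; {x (suc zero)} _ → lop }
      ; total      = trans (ℕ.+-comm c 1) 1+c≡m
      }

    -- If p has no color above c, then c is the last color: by `consecutive`, an end of e would
    -- otherwise have a larger one. If it has, the edge of color hi p is the next spine edge, and by
    -- `spoke` its color is the smallest at its far end. The fuel `n` bounds the number of remaining
    -- colors.
    layout : ∀ n {c q p e} → Joins G q p e → col e ≡ c → hi q ≡ c → lo p ≡ c → m ≤ c + n → Layout c q p
    layout n {c} {q} {p} {e} j ce hiq lop m≤ with c <? hi p
    layout n {c} {q} {p} {e} j ce hiq lop m≤ | no c≮hip =
      single j ce lop (ℕ.≤-antisym (subst (_< m) ce (toℕ<n (color e))) (ℕ.≮⇒≥ 1+c≮m))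
      where
      1+c≮m : ¬ (suc c < m)
      1+c≮m 1+c<m =
        let w , (e′ , w∈e′ , ce′) , c<hiw = consecutive 1+c<m
            e′≡e = col-injective (trans ce′ (sym ce))
        in Sum.[ (λ { refl → ℕ.<-irrefl (sym hiq) c<hiw }) , (λ { refl → c≮hip c<hiw }) ]
             (joins-incident {G} j (subst (IncidentWith w) e′≡e w∈e′))
    layout zero {c} {e = e} j ce hiq lop m≤ | yes _ =
      contradiction (subst (m ≤_) (trans (ℕ.+-identityʳ c) (sym ce)) m≤) (ℕ.<⇒≱ (toℕ<n (color e)))
    layout (suc n) {c} {q} {p} {e} j ce hiq lop m≤ | yes c<hip with ℕ.m≤n⇒∃[o]m+o≡n c<hip
    -- Here hi p = suc c + a, so `a` counts the colors strictly between c and hi p, those of the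
    -- pendant edges.
    ... | a , eq =
      let p′ , (e′ , j′ , ce′) , lop′ = spoke {p} {c + a} (subst (_≤ c + a) (sym lop) (ℕ.m≤m+n c a)) (ℕ.≤-reflexive eq)
          c+1+a = ℕ.+-suc c a
          hip   = trans (sym eq) (sym c+1+a)
      in extend a j ce lop hip
           (layout n j′ (trans ce′ (sym c+1+a)) hip (trans lop′ (sym c+1+a))
             (ℕ.≤-trans m≤ (subst (_≤ c + suc a + n) (sym (ℕ.+-suc c n))
               (ℕ.+-monoˡ-≤ n (subst (suc c ≤_) (sym c+1+a) (s≤s (ℕ.m≤m+n c a)))))))

    -- If both ends of the edge of color 0 had a larger color, both would have color 1, against
    -- `common-color`. So one end has hi = 0 and begins the spine; the argument witnesses that color
    -- 0 exists.
    start : E → ∃₂ λ q p → (∃[ e ] (Joins G q p e × col e ≡ 0)) × Layout 0 q p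
    start e with col-surjective (ℕ.≤-<-trans z≤n (toℕ<n (color e)))
    ... | e₀ , c₀ with someEnds {G} e₀
    ...   | u , v , j with 0 <? hi u
    ...     | no ¬0<hiu = u , v , (e₀ , j , c₀) , layout m j c₀ (ℕ.n≤0⇒n≡0 (ℕ.≮⇒≥ ¬0<hiu))
                (ℕ.n≤0⇒n≡0 (subst (lo v ≤_) c₀ (proj₁ (incident-bounds (proj₁ (proj₂ j)))))) ℕ.≤-refl
    ...     | yes 0<hiu with 0 <? hi v
    ...       | no ¬0<hiv = v , u , (e₀ , joins-sym {G} j , c₀) , layout m (joins-sym {G} j) c₀ (ℕ.n≤0⇒n≡0 (ℕ.≮⇒≥ ¬0<hiv))
                (ℕ.n≤0⇒n≡0 (subst (lo u ≤_) c₀ (proj₁ (incident-bounds (proj₁ j))))) ℕ.≤-refl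
    ...       | yes 0<hiv = contradiction (trans (sym c₀) (common-color j
                (has (ℕ.≤-trans (subst (lo u ≤_) c₀ (proj₁ (incident-bounds (proj₁ j)))) z≤n) 0<hiu)
                (has (ℕ.≤-trans (subst (lo v ≤_) c₀ (proj₁ (incident-bounds (proj₁ (proj₂ j))))) z≤n) 0<hiv))) λ ()

  module _ {q p} (qp : ∃[ e ] (Joins G q p e × col e ≡ 0)) (L : Layout 0 q p) where
    open Layout L

    private
      lo-q : lo q ≡ 0
      lo-q = let _ , (q∈e , _) , ce = qp in ℕ.n≤0⇒n≡0 (subst (lo q ≤_) ce (proj₁ (incident-bounds q∈e)))

      -- The smallest color does not separate q from p, as it is 0 at both. But a nonroot vertex
      -- placed at q has label 0, hence is `x (suc zero)`, which is placed at p.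
      place≢q : ∀ {v} → v ≢ x zero → place v ≢ q
      place≢q {v} v≢ eq = proj₂ (proj₂ (proj₁ (proj₂ qp)))
        (trans (sym eq) (trans (cong place v≡x₁) place-next))
        where
        v≡x₁ : v ≡ x (suc zero)
        v≡x₁ = label-injective 0 A v≢ (λ ()) (trans (sym (place-lo v≢)) (trans (cong lo eq) lo-q))

      place-injective : ∀ {v w} → place v ≡ place w → v ≡ w
      place-injective {v} {w} eq with root? v | root? w
      ... | yes refl | yes refl = refl
      ... | yes refl | no w≢    = contradiction (trans (sym eq) place-root) (place≢q w≢)
      ... | no v≢    | yes refl = contradiction (trans eq place-root) (place≢q v≢)
      ... | no v≢    | no w≢    = label-injective 0 A v≢ w≢
        (trans (sym (place-lo v≢)) (trans (cong lo eq) (place-lo w≢)))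

      -- By `total` the labels run through all colors, and a color determines its edge.
      place-covers : ∀ e → ∃₂ λ u v → Edge A u v × Joins G (place u) (place v) e
      place-covers e with label-surjective _+_ (col e) (λ _ _ _ → refl) 0 A z≤n ℕ.≤-refl
                            (subst (col e <_) (sym total) (toℕ<n (color e)))
      ... | v , v≢ , eq with place-edge (par-edge v≢)
      ...   | e′ , j , ce′ with refl ← col-injective {e} {e′} (sym (trans ce′ eq)) =
        par v , v , par-edge v≢ , j

      abstract
        -- The color set of w is nonempty, so w is an end of some edge, and both ends of every edge
        -- are placed.
        place-surjective : ∀ w → ∃[ v ] place v ≡ w
        place-surjective w with has {w} ℕ.≤-refl (lo≤hi w)
        ... | e , w∈e , _ with place-covers e
        ...   | u , v , _ , j with joins-incident {G} j w∈e
        ...     | inj₁ refl = u , refl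
        ...     | inj₂ refl = v , refl

      at : V → Vertex A
      at w = proj₁ (place-surjective w)

      place-at : ∀ w → place (at w) ≡ w
      place-at w = proj₂ (place-surjective w)

      at-unique : ∀ {v w} → w ≡ place v → v ≡ at w
      at-unique {v} {w} eq = place-injective (trans (sym eq) (sym (place-at w)))

      adjacent-at : ∀ {u v} → u ~ v → Adjacent A (at u) (at v)
      adjacent-at {u} {v} u~v =
        let e , uv         = edge-of {G} u~v
            a , b , ab , j = place-covers e
        in Sum.[ (λ (p , q) → subst₂ (Adjacent A) (at-unique p) (at-unique q) (fwd ab))
               , (λ (p , q) → subst₂ (Adjacent A) (at-unique p) (at-unique q) (bwd ab))
               ] (joins-ends-agree {G} {e = e} uv j)

      adjacent-place : ∀ {a b} → Adjacent A a b → place a ~ place b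
      adjacent-place (fwd ab) = joins⇒~ {G} (proj₁ (proj₂ (place-edge ab)))
      adjacent-place (bwd ba) = ~-sym (joins⇒~ {G} (proj₁ (proj₂ (place-edge ba))))

    isomorphism : Isomorphism _~_ (Adjacent A)
    isomorphism = record
      { bijection = mk↔ₛ′ at place (λ v → sym (at-unique refl)) place-at
      ; adjacency = λ u v → mk⇔ (adjacent-at {u} {v})
          (λ adj → subst₂ _~_ (place-at u) (place-at v) (adjacent-place {at u} {at v} adj))
      }

  caterpillar : HasEdge → ∃₂ λ k (A : Vec ℕ k) → Isomorphism _~_ (Adjacent A)
  caterpillar (_ , _ , u~v) = let _ , _ , qp , L = start (proj₁ (edge-of {G} u~v)) in
    _ , Layout.A L , isomorphism qp L

-- Extracting an interval bijection from the value of μ₂₁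

-- Searches the finitely many codes of functions. Decoding returns g only up to pointwise equality,
-- which P therefore has to respect.
anyFunction? : ∀ {m n} {P : Pred (Fin m → Fin n) 0ℓ} → (∀ {g h} → g ≗ h → P g → P h) →
               Decidable P → Dec (∃ P)
anyFunction? resp P? = map′ (λ (i , p) → finToFun i , p)
  (λ (g , p) → funToFin g , resp (sym ∘ finToFun-funToFin g) p) (any? (P? ∘ finToFun))

-- If j were missed, punching it out would inject `Fin (suc n)` into `Fin n`.
injective⇒surjective : ∀ {n} {g : Fin n → Fin n} → Injective _≡_ _≡_ g → ∀ j → ∃[ i ] g i ≡ j
injective⇒surjective {suc n} {g} inj j with any? (λ i → g i Fin.≟ j)
... | yes hit = hit
... | no  miss = contradiction
  (Fin.injective⇒≤ {f = λ i → punchOut {i = j} {g i} (λ eq → miss (i , sym eq))}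
    (inj ∘ punchOut-injective {i = j} _ _)) ℕ.1+n≰n

-- A section of g is injective, hence surjective, so every argument of g is a chosen preimage.
surjective⇒injective : ∀ {n} {g : Fin n → Fin n} → (∀ j → ∃[ i ] g i ≡ j) → Injective _≡_ _≡_ g
surjective⇒injective {n} {g} surj {i} {i′} eq with preimage i | preimage i′
  where
  section-injective : Injective _≡_ _≡_ (proj₁ ∘ surj)
  section-injective {j} {j′} eq = trans (sym (proj₂ (surj j))) (trans (cong g eq) (proj₂ (surj j′)))
  preimage : ∀ i → ∃[ j ] proj₁ (surj j) ≡ i
  preimage = injective⇒surjective section-injective
... | j , refl | j′ , refl =
  cong (proj₁ ∘ surj) (trans (sym (proj₂ (surj j))) (trans eq (proj₂ (surj j′))))

-- Climb from k to ever larger elements of P until the bound stops the ascent. As P is not assumed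
-- decidable, the maximum is found only up to double negation. In `go`, `d` bounds the distance left
-- to n.
¬¬-greatest : ∀ {P : Pred ℕ 0ℓ} {k} n → (∀ {j} → P j → j ≤ n) → P k → ¬ ¬ ∃ (IsGreatest P)
¬¬-greatest {P} n bound Pk none = go n (ℕ.m≤n+m n _) Pk
  where
  go : ∀ d {k} → n ≤ k + d → ¬ P k
  go d {k} n≤ Pk = none (k , Pk , λ Pj → decidable-stable (_ ≤? k) (λ j≰k → above d n≤ Pj (ℕ.≰⇒> j≰k)))
    where
    above : ∀ d {j} → n ≤ k + d → P j → ¬ (k < j)
    above zero    n≤ Pj k<j = ℕ.<⇒≱ k<j (ℕ.≤-trans (bound Pj) (subst (n ≤_) (ℕ.+-identityʳ k) n≤))
    above (suc d) {j} n≤ Pj k<j = go d (ℕ.≤-trans n≤ (subst (_≤ j + d) (sym (ℕ.+-suc k d)) (ℕ.+-monoˡ-≤ d k<j))) Pj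

module _ {G : Graph} where
  open Graph G

  intervals : ∀ {t} (φ : α G t) → f φ ≡ ∣V∣ → ∀ w → IsInterval (S φ w)
  intervals φ eq w = decidable-stable (isInterval? (S? φ w)) λ ¬int →
    ℕ.<⇒≢ (List.filter-notAll (λ x → isInterval? (S? φ x)) (allFin ∣V∣) (lose (∈-allFin w) ¬int))
          (trans eq (sym (List.length-tabulate {n = ∣V∣} id)))

  bijectionFrom : (φ : α G ∣E∣) → f φ ≡ ∣V∣ → IsIntervalBijection G (α.color φ)
  bijectionFrom φ eq = (λ _ _ → surjective⇒injective hit) , hit , intervals φ eq
    where
    hit : ∀ c → ∃[ e ] α.color φ e ≡ c
    hit c = let e , p = α.surjective φ c in e , p refl

  isIntervalBijection? : Decidable (IsIntervalBijection G)
  isIntervalBijection? color =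
    all? (λ e → all? λ e′ → (color e Fin.≟ color e′) →-dec (e Fin.≟ e′))
    ×-dec all? (λ c → any? λ e → color e Fin.≟ c)
    ×-dec all? (λ w → isInterval? λ c → any? λ e → incidentWith? w e ×-dec (color e Fin.≟ c))

  isIntervalBijection-resp : ∀ {g h} → g ≗ h → IsIntervalBijection G g → IsIntervalBijection G h
  isIntervalBijection-resp g≗h (inj , surj , int) =
    (λ e e′ eq → inj e e′ (trans (g≗h e) (trans eq (sym (g≗h e′))))) ,
    (λ c → let e , eq = surj c in e , trans (sym (g≗h e)) eq) ,
    λ w → let a , b , a≤b , iff = int w in a , b , a≤b , λ c → mk⇔
      (λ (e , w∈e , eq) → Equivalence.to (iff c) (e , w∈e , trans (g≗h e) eq))
      (λ p → let e , w∈e , eq = Equivalence.from (iff c) p in e , w∈e , trans (sym (g≗h e)) eq)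

  -- Once μ₂(G, |E|) has a value, minimality makes it at least |V|, so a coloring attaining it has
  -- only intervals. The value exists up to double negation, and the goal is decidable, hence
  -- stable.
  intervalBijection : μ₂₁[ G ]≡ ∣V∣ → ∃ (IsIntervalBijection G)
  intervalBijection ((t , ((k , χ≡k , k≤t) , t≤E) , _) , least) =
    decidable-stable (anyFunction? isIntervalBijection-resp isIntervalBijection?) λ none →
      ¬¬-greatest {P = λ k → ∃[ φ ] f {G} {∣E∣} φ ≡ k} ∣V∣ (λ { (φ , refl) → f≤∣V∣ φ }) (identityColoring G , refl)
        λ { (k′ , μ₂≡k′@((φ , refl) , _)) → none (α.color φ , bijectionFrom φ
              (ℕ.≤-antisym (f≤∣V∣ φ) (least (∣E∣ , ((k , χ≡k , ℕ.≤-trans k≤t t≤E) , ℕ.≤-refl) , μ₂≡k′)))) }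

-- Isomorphisms and the final equivalence

isomorphism-trans : ∀ {U V W : Set} {R : Rel U 0ℓ} {R′ : Rel V 0ℓ} {R″ : Rel W 0ℓ} →
                    Isomorphism R R′ → Isomorphism R′ R″ → Isomorphism R R″
isomorphism-trans i j = record
  { bijection = Isomorphism.bijection j ↔-∘ Isomorphism.bijection i
  ; adjacency = λ u v → Isomorphism.adjacency j _ _ ⇔-∘ Isomorphism.adjacency i u v
  }

isomorphism-sym : ∀ {V W : Set} {R : Rel V 0ℓ} {R′ : Rel W 0ℓ} → Isomorphism R R′ → Isomorphism R′ R
isomorphism-sym {R = R} {R′} i = record
  { bijection = ↔-sym bijection
  ; adjacency = λ u v → mk⇔
      (λ uv → Equivalence.from (adjacency (from u) (from v)) (subst₂ R′ (sym (to-from u)) (sym (to-from v)) uv))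
      (λ uv → subst₂ R′ (to-from u) (to-from v) (Equivalence.to (adjacency (from u) (from v)) uv))
  }
  where
  open Isomorphism i
  to-from = Inverse.strictlyInverseˡ bijection

K₂≅T[] : Isomorphism K₂ (Adjacent [])
K₂≅T[] = record
  { bijection = mk↔ₛ′ x (λ { (x i) → i ; (y () _) }) (λ { (x i) → refl ; (y () _) }) (λ _ → refl)
  ; adjacency = λ i j → mk⇔ (adjacent i j) λ { (fwd (spine zero)) () ; (bwd (spine zero)) () }
  }
  where
  adjacent : ∀ i j → i ≢ j → Adjacent [] (x i) (x j)
  adjacent zero       zero       i≢j = contradiction refl i≢j
  adjacent zero       (suc zero) _   = fwd (spine zero)
  adjacent (suc zero) zero       _   = bwd (spine zero)
  adjacent (suc zero) (suc zero) i≢j = contradiction refl i≢j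

-- K₂ is T of the empty vector, so both clauses of `IsGalaxy` merge into one.
galaxy⇔caterpillar : ∀ G → IsGalaxy G ⇔ (∃₂ λ k (A : Vec ℕ k) → Isomorphism (Graph._~_ G) (Adjacent A))
galaxy⇔caterpillar G = mk⇔
  (λ { (inj₁ i) → 0 , [] , isomorphism-trans i K₂≅T[] ; (inj₂ (k , A , i)) → suc k , A , i })
  (λ { (zero , [] , i) → inj₁ (isomorphism-trans i (isomorphism-sym K₂≅T[])) ; (suc k , A , i) → inj₂ (k , A , i) })

intervalBijection⇒galaxy : ∀ {G} → Graph.Connected G → Graph.HasEdge G → ∃ (IsIntervalBijection G) → IsGalaxy G
intervalBijection⇒galaxy {G} connected hasEdge (color , good) =
  Equivalence.from (galaxy⇔caterpillar G) (FromBijection.caterpillar G connected color good hasEdge)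

caterpillar⇒μ₂₁ : ∀ {G} → (∃₂ λ k (A : Vec ℕ k) → Isomorphism (Graph._~_ G) (Adjacent A)) → μ₂₁[ G ]≡ (Graph.∣V∣ G)
caterpillar⇒μ₂₁ {G} (k , A , iso) = Caterpillar.μ₂₁≡∣V∣ {G} {k} A iso

theorem1 : (G : Graph) → Graph.Connected G → Graph.HasEdge G → μ₂₁[ G ]≡ (Graph.∣V∣ G) ⇔ IsGalaxy G
theorem1 G connected hasEdge = mk⇔
  (λ μ → intervalBijection⇒galaxy {G} connected hasEdge (intervalBijection {G} μ))
  (λ galaxy → caterpillar⇒μ₂₁ {G} (Equivalence.to (galaxy⇔caterpillar G) galaxy))
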